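{- Let $p(n)$ be an integral polynomial with $\deg p\geq 2$. Then there is no infinite sequence $(f_i)_{i\ge1}$ of pairwise distinct integers such that $f_j-f_i\in\{p(n):n\in\mathbb{Z}\}$ for all $i<j$; that is, $\{p(n):n\in\mathbb{Z}\}$ contains no $\Delta$-set.
   Context: An integral polynomial is a polynomial taking integer values at the integers. A set $A\subset\mathbb{Z}$ is a $\Delta$-set if it contains $\{x_j-x_i: j>i\}$ for some infinite sequence $(x_i)$ of pairwise distinct integers. -}

module Defs where

open import Data.Nat using (ℕ)
open import Data.Integer using (ℤ; _-_)
open import Data.Rational using (ℚ; _+_; _*_; 0ℚ; _/_)
open import Data.List using (List; []; _∷_; _++_; [_])
open import Data.Product using (∃)
open import Relation.Binary.PropositionalEquality using (_≡_)

-- embedding ℤ → ℚ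
toℚ : ℤ → ℚ
toℚ z = z / 1

-- a polynomial with rational coefficients, as coefficient list [c₀, c₁, …, c_d]
-- (c_i is the coefficient of xⁱ); evaluation by Horner's rule
eval : List ℚ → ℚ → ℚ
eval []       x = 0ℚ
eval (c ∷ cs) x = c + x * eval cs x

-- the polynomial takes integer values at all integers
IsIntegral : List ℚ → Set
IsIntegral cs = ∀ (n : ℤ) → ∃ λ (m : ℤ) → eval cs (toℚ n) ≡ toℚ m

-- z lies in the value set {p(n) : n ∈ ℤ}
InValues : List ℚ → ℤ → Set
InValues cs z = ∃ λ (n : ℤ) → eval cs (toℚ n) ≡ toℚ z

-- Multiplying p and f by a common denominator of the coefficients of p, we may assume that
-- p = P has integer coefficients, with leading coefficient c ≠ 0.
-- Let D = f 1 - f 0 ≠ 0 and, for j ≥ 2, write f j - f 0 = P (a j)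
-- and f j - f 1 = P (b j). Then P (a j) - P (b j) = D and the b j are pairwise distinct.
-- Since a - b divides P a - P b, the shift k = a j - b j is one of finitely many divisors of D.
-- For each such k the difference Δ[ k ] P x = P (x + k) - P x is not constant (deg P ≥ 2),
-- so Δ[ k ] P t ≠ D for some t; then every solution b of Δ[ k ] P b = D satisfies
-- b - t ∣ D - Δ[ k ] P t ≠ 0. So the b j are bounded, contradicting their distinctness.

module Submission where

open import Defs
open import Data.Nat using (ℕ; _≤_; _<_)
open import Data.Integer using (ℤ; _-_)
open import Data.Rational using (ℚ)
open import Data.List using (List; _++_; [_]; length)
open import Data.Product using (∃; _×_)
open import Relation.Nullary using (¬_)
open import Relation.Binary.PropositionalEquality using (_≡_; _≢_)
open import Function.Definitions using (Injective)

open import Data.Nat as ℕ using (zero; suc; z≤n; s≤s)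
import Data.Nat.Properties as ℕ
import Data.Nat.Divisibility as ℕ using (∣⇒≤)
open import Data.Integer using (+_; -[1+_]; 0ℤ; sign; _◃_; _+_; _*_; ∣_∣; _≟_; ≢-nonZero)
import Data.Integer.Properties as ℤ
open import Data.Integer.Divisibility.Signed
  using (_∣_; divides; ∣-refl; ∣m∣n⇒∣m+n; ∣m∣n⇒∣m-n; ∣m⇒∣m*n; ∣n⇒∣m*n; ∣⇒∣ᵤ)
open import Data.Integer.Tactic.RingSolver using (solve-∀)
open import Data.Rational as ℚ using (mkℚ; ↥_; ↧_; 0ℚ)
import Data.Rational.Properties as ℚ
open import Data.Rational.Unnormalised as ℚᵘ using (mkℚᵘ; *≡*)
import Data.Rational.Unnormalised.Properties as ℚᵘ
open import Data.Rational.Solver using (module +-*-Solver)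
import Data.Nat.Coprimality as Coprimality
open import Data.List using ([]; _∷_; map)
import Data.List.Properties as List
open import Data.Product using (_,_; proj₁; proj₂; uncurry)
open import Data.Sum using ([_,_]′)
open import Data.Sign using (Sign)
open import Data.Fin using (Fin; toℕ; fromℕ<; combine; remQuot)
open import Data.Fin.Patterns using (0F; 1F)
import Data.Fin.Properties as Fin
open import Data.Empty using (⊥-elim)
open import Function using (_∘_; id)
open import Relation.Nullary using (yes; no)
open import Relation.Binary.PropositionalEquality
  using (refl; sym; trans; cong; cong₂; subst; subst₂; module ≡-Reasoning)

evalℤ : List ℤ → ℤ → ℤ
evalℤ []       x = 0ℤ
evalℤ (c ∷ cs) x = c + x * evalℤ cs x

evalℤ-[c] : ∀ c x → evalℤ [ c ] x ≡ c
evalℤ-[c] c x = trans (cong (λ v → c + v) (ℤ.*-zeroʳ x)) (ℤ.+-identityʳ c)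

evalℤ-scale : ∀ k cs x → evalℤ (map (k *_) cs) x ≡ k * evalℤ cs x
evalℤ-scale k []       x = sym (ℤ.*-zeroʳ k)
evalℤ-scale k (c ∷ cs) x = begin
  k * c + x * evalℤ (map (k *_) cs) x ≡⟨ cong (λ v → k * c + x * v) (evalℤ-scale k cs x) ⟩
  k * c + x * (k * evalℤ cs x)         ≡⟨ distrib k c x (evalℤ cs x) ⟩
  k * (c + x * evalℤ cs x)             ∎
  where
  open ≡-Reasoning
  distrib : ∀ k c x v → k * c + x * (k * v) ≡ k * (c + x * v)
  distrib = solve-∀

m*n≡0⇒n≡0 : ∀ {m n} → m * n ≡ 0ℤ → m ≢ 0ℤ → n ≡ 0ℤ
m*n≡0⇒n≡0 {m} mn≡0 m≢0 = [ ⊥-elim ∘ m≢0 , id ]′ (ℤ.i*j≡0⇒i≡0∨j≡0 m mn≡0)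

synthetic-division : ∀ p ps c t → ∃ λ qs → length qs ≡ length ps ×
  (∀ y → evalℤ (p ∷ ps ++ [ c ]) y ≡ evalℤ (p ∷ ps ++ [ c ]) t + (y - t) * evalℤ (qs ++ [ c ]) y)
synthetic-division p []        c t = [] , refl , λ y → linear p c y t
  where
  linear : ∀ p c y t → p + y * (c + y * 0ℤ) ≡ (p + t * (c + t * 0ℤ)) + (y - t) * (c + y * 0ℤ)
  linear = solve-∀
synthetic-division p (p′ ∷ ps) c t with synthetic-division p′ ps c t
... | qs , length-qs , divides-tail =
  P′ t ∷ qs , cong suc length-qs ,
  λ y → trans (cong (λ v → p + y * v) (divides-tail y)) (horner p y t (P′ t) (evalℤ (qs ++ [ c ]) y))
  where
  P′ : ℤ → ℤ
  P′ = evalℤ (p′ ∷ ps ++ [ c ])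
  horner : ∀ p y t a q → p + y * (a + (y - t) * q) ≡ (p + t * a) + (y - t) * (a + y * q)
  horner = solve-∀

roots⇒leading≡0 : ∀ ps c (x : ℕ → ℤ) → Injective _≡_ _≡_ x →
  (∀ m → m ≤ length ps → evalℤ (ps ++ [ c ]) (x m) ≡ 0ℤ) → c ≡ 0ℤ
roots⇒leading≡0 ps c = go (length ps) ps refl
  where
  go : ∀ n ps → length ps ≡ n → (x : ℕ → ℤ) → Injective _≡_ _≡_ x →
    (∀ m → m ≤ n → evalℤ (ps ++ [ c ]) (x m) ≡ 0ℤ) → c ≡ 0ℤ
  go zero    (_ ∷ _)  ()
  go n       []       _ x _ vanishes = trans (sym (evalℤ-[c] c (x 0))) (vanishes 0 z≤n)
  go (suc n) (p ∷ ps) length-ps x x-inj vanishes with synthetic-division p ps c (x 0)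
  ... | qs , length-qs , division =
    go n qs (trans length-qs (ℕ.suc-injective length-ps)) (x ∘ suc) (ℕ.suc-injective ∘ x-inj)
      quotient-vanishes
    where
    P Q : ℤ → ℤ
    P = evalℤ (p ∷ ps ++ [ c ])
    Q = evalℤ (qs ++ [ c ])
    quotient-vanishes : ∀ m → m ≤ n → Q (x (suc m)) ≡ 0ℤ
    quotient-vanishes m m≤n = m*n≡0⇒n≡0 (begin
      (y - x 0) * Q y           ≡⟨ ℤ.+-identityˡ _ ⟨
      0ℤ + (y - x 0) * Q y      ≡⟨ cong (λ v → v + (y - x 0) * Q y) (vanishes 0 z≤n) ⟨
      P (x 0) + (y - x 0) * Q y ≡⟨ division y ⟨
      P y                       ≡⟨ vanishes (suc m) (s≤s m≤n) ⟩
      0ℤ                        ∎)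
      (ℕ.1+n≢0 ∘ x-inj ∘ ℤ.i-j≡0⇒i≡j _ _)
      where
      open ≡-Reasoning
      y : ℤ
      y = x (suc m)

DivisibleDifferences : (ℤ → ℤ) → Set
DivisibleDifferences F = ∀ a b → (a - b) ∣ (F a - F b)

evalℤ-divisibleDifferences : ∀ cs → DivisibleDifferences (evalℤ cs)
evalℤ-divisibleDifferences []       a b = divides 0ℤ refl
evalℤ-divisibleDifferences (c ∷ cs) a b =
  subst ((a - b) ∣_) (sym (split c a b (evalℤ cs a) (evalℤ cs b)))
    (∣m∣n⇒∣m+n (∣m⇒∣m*n (evalℤ cs a) ∣-refl) (∣n⇒∣m*n b (evalℤ-divisibleDifferences cs a b)))
  where
  split : ∀ c a b A B → (c + a * A) - (c + b * B) ≡ (a - b) * A + b * (A - B)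
  split = solve-∀

Δ[_] : ℤ → (ℤ → ℤ) → ℤ → ℤ
Δ[ k ] F x = F (x + k) - F x

Δ-divisibleDifferences : ∀ {F} k → DivisibleDifferences F → DivisibleDifferences (Δ[ k ] F)
Δ-divisibleDifferences {F} k F-div a b =
  subst₂ _∣_ (shift-cancels a b k) (regroup (F (a + k)) (F (b + k)) (F a) (F b))
    (∣m∣n⇒∣m-n (F-div (a + k) (b + k)) (subst (_∣ (F a - F b)) (sym (shift-cancels a b k)) (F-div a b)))
  where
  shift-cancels : ∀ a b k → (a + k) - (b + k) ≡ a - b
  shift-cancels = solve-∀
  regroup : ∀ A B C E → (A - B) - (C - E) ≡ (A - C) - (B - E)
  regroup = solve-∀

∣⇒∣∣≤∣∣ : ∀ {k i} → k ∣ i → i ≢ 0ℤ → ∣ k ∣ ℕ.≤ ∣ i ∣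
∣⇒∣∣≤∣∣ k∣i i≢0 = ℕ.∣⇒≤ {{ℕ.≢-nonZero (i≢0 ∘ ℤ.∣i∣≡0⇒i≡0)}} (∣⇒∣ᵤ k∣i)

fibre-bound : ∀ {F t D b} → DivisibleDifferences F → F t ≢ D → F b ≡ D →
  ∣ b ∣ ℕ.≤ ∣ t ∣ ℕ.+ ∣ D - F t ∣
fibre-bound {F} {t} {D} {b} F-div Ft≢D Fb≡D = begin
  ∣ b ∣             ≡⟨ cong ∣_∣ (t+[b-t] t b) ⟨
  ∣ t + (b - t) ∣    ≤⟨ ℤ.∣i+j∣≤∣i∣+∣j∣ t (b - t) ⟩
  ∣ t ∣ ℕ.+ ∣ b - t ∣ ≤⟨ ℕ.+-monoʳ-≤ ∣ t ∣ (∣⇒∣∣≤∣∣ b-t∣D-Ft D-Ft≢0) ⟩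
  ∣ t ∣ ℕ.+ ∣ D - F t ∣ ∎
  where
  open ℕ.≤-Reasoning
  t+[b-t] : ∀ t b → t + (b - t) ≡ b
  t+[b-t] = solve-∀
  b-t∣D-Ft : (b - t) ∣ (D - F t)
  b-t∣D-Ft = subst (λ v → (b - t) ∣ (v - F t)) Fb≡D (F-div b t)
  D-Ft≢0 : D - F t ≢ 0ℤ
  D-Ft≢0 = Ft≢D ∘ sym ∘ ℤ.i-j≡0⇒i≡j D (F t)

Δ-constant⇒affine : ∀ {F k D} L → (∀ m → m < L → Δ[ k ] F (+ m * k) ≡ D) →
  ∀ m → m ≤ L → F (+ m * k) ≡ F 0ℤ + + m * D
Δ-constant⇒affine L Δ≡D zero    _   = sym (ℤ.+-identityʳ _)
Δ-constant⇒affine {F} {k} {D} L Δ≡D (suc m) m<L = begin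
  F (+ suc m * k)                   ≡⟨ cong F (trans (ℤ.suc-* (+ m) k) (ℤ.+-comm k (+ m * k))) ⟩
  F (+ m * k + k)                   ≡⟨ sym (sub-add (F (+ m * k + k)) (F (+ m * k))) ⟩
  Δ[ k ] F (+ m * k) + F (+ m * k)  ≡⟨ cong₂ _+_ (Δ≡D m m<L) (Δ-constant⇒affine {F} L Δ≡D m (ℕ.<⇒≤ m<L)) ⟩
  D + (F 0ℤ + + m * D)              ≡⟨ collect D (F 0ℤ) (+ m) ⟩
  F 0ℤ + + suc m * D                ∎
  where
  open ≡-Reasoning
  sub-add : ∀ a b → (a - b) + b ≡ a
  sub-add = solve-∀
  collect : ∀ D a m → D + (a + m * D) ≡ a + (+ 1 + m) * D
  collect = solve-∀

-- If Δ[ k ] P were D at 0, k, …, (L - 1)k, then P (m k) = P 0 + m D for m ≤ L, so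
-- k (P x - P 0) - D x has L + 1 roots; as L ≥ 2 its leading coefficient is k c ≠ 0.
Δ-nonconstant : ∀ ps c → c ≢ 0ℤ → 2 ≤ length ps → ∀ {k D} → k ≢ 0ℤ →
  ¬ (∀ m → m < length ps → Δ[ k ] (evalℤ (ps ++ [ c ])) (+ m * k) ≡ D)
Δ-nonconstant []             _ _ ()
Δ-nonconstant (_ ∷ [])       _ _ (s≤s ())
Δ-nonconstant (p₀ ∷ p₁ ∷ ps) c c≢0 _ {k} {D} k≢0 Δ≡D =
  [ k≢0 , c≢0 ]′ (ℤ.i*j≡0⇒i≡0∨j≡0 k
    (roots⇒leading≡0 qs (k * c) (λ m → + m * k) multiples-injective vanishes-on-multiples))
  where
  P : ℤ → ℤ
  P = evalℤ (p₀ ∷ p₁ ∷ ps ++ [ c ])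
  qs : List ℤ
  qs = 0ℤ ∷ (k * p₁ - D) ∷ map (k *_) ps
  evalℤ-qs : ∀ x → evalℤ (qs ++ [ k * c ]) x ≡ k * (P x - p₀) - D * x
  evalℤ-qs x = begin
    0ℤ + x * ((k * p₁ - D) + x * evalℤ (map (k *_) ps ++ [ k * c ]) x)
      ≡⟨ cong (λ v → 0ℤ + x * ((k * p₁ - D) + x * evalℤ v x)) (sym (List.map-++ (k *_) ps [ c ])) ⟩
    0ℤ + x * ((k * p₁ - D) + x * evalℤ (map (k *_) (ps ++ [ c ])) x)
      ≡⟨ cong (λ v → 0ℤ + x * ((k * p₁ - D) + x * v)) (evalℤ-scale k (ps ++ [ c ]) x) ⟩
    0ℤ + x * ((k * p₁ - D) + x * (k * R))
      ≡⟨ expand k p₀ p₁ D x R ⟩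
    k * ((p₀ + x * (p₁ + x * R)) - p₀) - D * x ∎
    where
    open ≡-Reasoning
    R : ℤ
    R = evalℤ (ps ++ [ c ]) x
    expand : ∀ k p₀ p₁ D x R →
      0ℤ + x * ((k * p₁ - D) + x * (k * R)) ≡ k * ((p₀ + x * (p₁ + x * R)) - p₀) - D * x
    expand = solve-∀
  multiples-injective : Injective _≡_ _≡_ (λ m → + m * k)
  multiples-injective eq = ℤ.+-injective (ℤ.*-cancelʳ-≡ _ _ k {{≢-nonZero k≢0}} eq)
  vanishes-on-multiples : ∀ m → m ≤ length qs → evalℤ (qs ++ [ k * c ]) (+ m * k) ≡ 0ℤ
  vanishes-on-multiples m m≤ = begin
    evalℤ (qs ++ [ k * c ]) (+ m * k)        ≡⟨ evalℤ-qs (+ m * k) ⟩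
    k * (P (+ m * k) - p₀) - D * (+ m * k)  ≡⟨ cong (λ v → k * (v - p₀) - D * (+ m * k)) P-affine ⟩
    k * ((p₀ + + m * D) - p₀) - D * (+ m * k) ≡⟨ cancel k p₀ (+ m) D ⟩
    0ℤ                                        ∎
    where
    open ≡-Reasoning
    P-affine : P (+ m * k) ≡ p₀ + + m * D
    P-affine = trans (Δ-constant⇒affine {P} _ Δ≡D m m≤length)
                     (cong (λ v → v + + m * D) (ℤ.+-identityʳ p₀))
      where
      m≤length : m ≤ length (p₀ ∷ p₁ ∷ ps)
      m≤length = subst (m ≤_) (cong (suc ∘ suc) (List.length-map (k *_) ps)) m≤
    cancel : ∀ k p₀ m D → k * ((p₀ + m * D) - p₀) - D * (m * k) ≡ 0ℤ
    cancel = solve-∀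

Δ-avoids : ∀ ps c → c ≢ 0ℤ → 2 ≤ length ps → ∀ {k} D → k ≢ 0ℤ →
  ∃ λ t → Δ[ k ] (evalℤ (ps ++ [ c ])) t ≢ D
Δ-avoids ps c c≢0 2≤len {k} D k≢0
  with Fin.¬∀⟶∃¬ (length ps) Hits (λ i → Δ[ k ] P (+ toℕ i * k) ≟ D) ¬all-hit
  where
  P : ℤ → ℤ
  P = evalℤ (ps ++ [ c ])
  Hits : Fin (length ps) → Set
  Hits i = Δ[ k ] P (+ toℕ i * k) ≡ D
  ¬all-hit : ¬ (∀ i → Hits i)
  ¬all-hit all-hit = Δ-nonconstant ps c c≢0 2≤len k≢0 λ m m<len →
    subst (λ n → Δ[ k ] P (+ n * k) ≡ D) (Fin.toℕ-fromℕ< m<len) (all-hit (fromℕ< m<len))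
... | i , misses = + toℕ i * k , misses

maxOnBall : (ℤ → ℕ) → ℕ → ℕ
maxOnBall β zero    = β 0ℤ
maxOnBall β (suc N) = maxOnBall β N ℕ.⊔ (β (+ suc N) ℕ.⊔ β -[1+ N ])

maxOnBall-mono : ∀ β {m n} → m ≤ n → maxOnBall β m ≤ maxOnBall β n
maxOnBall-mono β m≤n = go (ℕ.≤⇒≤′ m≤n)
  where
  go : ∀ {m n} → m ℕ.≤′ n → maxOnBall β m ≤ maxOnBall β n
  go ℕ.≤′-refl        = ℕ.≤-refl
  go (ℕ.≤′-step m≤′n) = ℕ.≤-trans (go m≤′n) (ℕ.m≤m⊔n _ _)

≤-maxOnBall : ∀ β k {N} → ∣ k ∣ ≤ N → β k ≤ maxOnBall β N
≤-maxOnBall β k {N} ∣k∣≤N = ℕ.≤-trans (≤-maxOnBall-∣∣ k) (maxOnBall-mono β ∣k∣≤N)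
  where
  ≤-maxOnBall-∣∣ : ∀ k → β k ≤ maxOnBall β ∣ k ∣
  ≤-maxOnBall-∣∣ (+ zero)  = ℕ.≤-refl
  ≤-maxOnBall-∣∣ (+ suc n) = ℕ.≤-trans (ℕ.m≤m⊔n (β (+ suc n)) _) (ℕ.m≤n⊔m (maxOnBall β n) _)
  ≤-maxOnBall-∣∣ -[1+ n ]  = ℕ.≤-trans (ℕ.m≤n⊔m (β (+ suc n)) _) (ℕ.m≤n⊔m (maxOnBall β n) _)

signFin : Sign → Fin 2
signFin Sign.- = 0F
signFin Sign.+ = 1F

signFin-injective : Injective _≡_ _≡_ signFin
signFin-injective {Sign.-} {Sign.-} _ = refl
signFin-injective {Sign.+} {Sign.+} _ = refl

bounded⇒¬injective : ∀ {h : ℕ → ℤ} B → (∀ j → ∣ h j ∣ ≤ B) → ¬ Injective _≡_ _≡_ h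
bounded⇒¬injective {h} B bounded h-inj = Fin.<⇒notInjective (ℕ.n<1+n _) code-injective
  where
  digits : ℕ → Fin 2 × Fin (suc B)
  digits j = signFin (sign (h j)) , fromℕ< (s≤s (bounded j))
  code : Fin (suc (2 ℕ.* suc B)) → Fin (2 ℕ.* suc B)
  code = uncurry combine ∘ digits ∘ toℕ
  code-injective : Injective _≡_ _≡_ code
  code-injective {i} {j} eq = Fin.toℕ-injective (h-inj (begin
    h (toℕ i)                       ≡⟨ ℤ.signᵢ◃∣i∣≡i _ ⟨
    sign (h (toℕ i)) ◃ ∣ h (toℕ i) ∣ ≡⟨ cong₂ _◃_ (signFin-injective (cong proj₁ parts)) abs-eq ⟩
    sign (h (toℕ j)) ◃ ∣ h (toℕ j) ∣ ≡⟨ ℤ.signᵢ◃∣i∣≡i _ ⟩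
    h (toℕ j)                       ∎))
    where
    open ≡-Reasoning
    parts : digits (toℕ i) ≡ digits (toℕ j)
    parts = trans (sym (Fin.remQuot-combine _ _))
                  (trans (cong (remQuot (suc B)) eq) (Fin.remQuot-combine _ _))
    abs-eq : ∣ h (toℕ i) ∣ ≡ ∣ h (toℕ j) ∣
    abs-eq = trans (sym (Fin.toℕ-fromℕ< _)) (trans (cong (toℕ ∘ proj₂) parts) (Fin.toℕ-fromℕ< _))

difference-preimages-bounded : ∀ ps c → c ≢ 0ℤ → 2 ≤ length ps → ∀ {D} → D ≢ 0ℤ →
  ∃ λ B → ∀ a b → evalℤ (ps ++ [ c ]) a - evalℤ (ps ++ [ c ]) b ≡ D → ∣ b ∣ ≤ B
difference-preimages-bounded ps c c≢0 2≤len {D} D≢0 = maxOnBall β ∣ D ∣ , bound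
  where
  P : ℤ → ℤ
  P = evalℤ (ps ++ [ c ])
  avoids : ∀ k → ∃ λ t → Δ[ k ] P t ≢ D
  avoids k with k ≟ 0ℤ
  ... | yes refl = 0ℤ , λ Δ₀≡D → D≢0 (trans (sym Δ₀≡D) (ℤ.+-inverseʳ (P 0ℤ)))
  ... | no k≢0   = Δ-avoids ps c c≢0 2≤len D k≢0
  β : ℤ → ℕ
  β k = ∣ proj₁ (avoids k) ∣ ℕ.+ ∣ D - Δ[ k ] P (proj₁ (avoids k)) ∣
  bound : ∀ a b → P a - P b ≡ D → ∣ b ∣ ≤ maxOnBall β ∣ D ∣
  bound a b Pa-Pb≡D = ℕ.≤-trans
    (fibre-bound {Δ[ a - b ] P} (Δ-divisibleDifferences {P} (a - b) P-div)
      (proj₂ (avoids (a - b))) Δ[a-b]P[b]≡D)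
    (≤-maxOnBall β (a - b) (∣⇒∣∣≤∣∣ (subst ((a - b) ∣_) Pa-Pb≡D (P-div a b)) D≢0))
    where
    P-div : DivisibleDifferences P
    P-div = evalℤ-divisibleDifferences (ps ++ [ c ])
    b+[a-b]≡a : ∀ a b → b + (a - b) ≡ a
    b+[a-b]≡a = solve-∀
    Δ[a-b]P[b]≡D : Δ[ a - b ] P b ≡ D
    Δ[a-b]P[b]≡D = trans (cong (λ x → P x - P b) (b+[a-b]≡a a b)) Pa-Pb≡D

no-Δ-sequence-in-values : ∀ ps c → c ≢ 0ℤ → 2 ≤ length ps → (g : ℕ → ℤ) → Injective _≡_ _≡_ g →
  ¬ (∀ i j → i < j → ∃ λ n → evalℤ (ps ++ [ c ]) n ≡ g j - g i)
no-Δ-sequence-in-values ps c c≢0 2≤len g g-inj in-values =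
  bounded⇒¬injective B (λ j → bound (a j) (b j) (Pa-Pb≡D j)) b-injective
  where
  P : ℤ → ℤ
  P = evalℤ (ps ++ [ c ])
  D : ℤ
  D = g 1 - g 0
  D≢0 : D ≢ 0ℤ
  D≢0 = ℕ.1+n≢0 ∘ g-inj ∘ ℤ.i-j≡0⇒i≡j _ _
  B : ℕ
  B = proj₁ (difference-preimages-bounded ps c c≢0 2≤len D≢0)
  bound : ∀ a b → P a - P b ≡ D → ∣ b ∣ ≤ B
  bound = proj₂ (difference-preimages-bounded ps c c≢0 2≤len D≢0)
  a b : ℕ → ℤ
  a j = proj₁ (in-values 0 (2 ℕ.+ j) (s≤s z≤n))
  b j = proj₁ (in-values 1 (2 ℕ.+ j) (s≤s (s≤s z≤n)))
  Pa≡ : ∀ j → P (a j) ≡ g (2 ℕ.+ j) - g 0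
  Pa≡ j = proj₂ (in-values 0 (2 ℕ.+ j) (s≤s z≤n))
  Pb≡ : ∀ j → P (b j) ≡ g (2 ℕ.+ j) - g 1
  Pb≡ j = proj₂ (in-values 1 (2 ℕ.+ j) (s≤s (s≤s z≤n)))
  Pa-Pb≡D : ∀ j → P (a j) - P (b j) ≡ D
  Pa-Pb≡D j = trans (cong₂ _-_ (Pa≡ j) (Pb≡ j)) (telescope (g (2 ℕ.+ j)) (g 0) (g 1))
    where
    telescope : ∀ x y z → (x - y) - (x - z) ≡ z - y
    telescope = solve-∀
  b-injective : Injective _≡_ _≡_ b
  b-injective {i} {j} bi≡bj = ℕ.suc-injective (ℕ.suc-injective (g-inj (ℤ.i-j≡0⇒i≡j _ _ (begin
    x - y                 ≡⟨ regroup x y (g 1) ⟩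
    (x - g 1) - (y - g 1) ≡⟨ cong₂ _-_ (Pb≡ i) (Pb≡ j) ⟨
    P (b i) - P (b j)     ≡⟨ cong (λ v → P v - P (b j)) bi≡bj ⟩
    P (b j) - P (b j)     ≡⟨ ℤ.+-inverseʳ (P (b j)) ⟩
    0ℤ                    ∎))))
    where
    open ≡-Reasoning
    x y : ℤ
    x = g (2 ℕ.+ i)
    y = g (2 ℕ.+ j)
    regroup : ∀ x y z → x - y ≡ (x - z) - (y - z)
    regroup = solve-∀

toℚ≡mkℚ : ∀ z → toℚ z ≡ mkℚ z 0 (Coprimality.sym (Coprimality.1-coprimeTo ∣ z ∣))
toℚ≡mkℚ z = ℚ.↥p/↧p≡p (mkℚ z 0 _)

toℚ-injective : Injective _≡_ _≡_ toℚ
toℚ-injective {x} {y} eq = cong ↥_ (trans (sym (toℚ≡mkℚ x)) (trans eq (toℚ≡mkℚ y)))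

toℚᵘ-toℚ : ∀ z → ℚ.toℚᵘ (toℚ z) ≡ mkℚᵘ z 0
toℚᵘ-toℚ z = cong ℚ.toℚᵘ (toℚ≡mkℚ z)

toℚ-+ : ∀ x y → toℚ (x + y) ≡ toℚ x ℚ.+ toℚ y
toℚ-+ x y = ℚ.toℚᵘ-injective (begin
  ℚ.toℚᵘ (toℚ (x + y))                       ≡⟨ toℚᵘ-toℚ (x + y) ⟩
  mkℚᵘ (x + y) 0                             ≈⟨ *≡* (over-1 x y) ⟩
  mkℚᵘ x 0 ℚᵘ.+ mkℚᵘ y 0                     ≡⟨ cong₂ ℚᵘ._+_ (toℚᵘ-toℚ x) (toℚᵘ-toℚ y) ⟨
  ℚ.toℚᵘ (toℚ x) ℚᵘ.+ ℚ.toℚᵘ (toℚ y)         ≈⟨ ℚ.toℚᵘ-homo-+ (toℚ x) (toℚ y) ⟨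
  ℚ.toℚᵘ (toℚ x ℚ.+ toℚ y)                   ∎)
  where
  open ℚᵘ.≃-Reasoning
  over-1 : ∀ x y → (x + y) * + 1 ≡ (x * + 1 + y * + 1) * + 1
  over-1 = solve-∀

toℚ-* : ∀ x y → toℚ (x * y) ≡ toℚ x ℚ.* toℚ y
toℚ-* x y = ℚ.toℚᵘ-injective (begin
  ℚ.toℚᵘ (toℚ (x * y))                       ≡⟨ toℚᵘ-toℚ (x * y) ⟩
  mkℚᵘ (x * y) 0                             ≡⟨ cong₂ ℚᵘ._*_ (toℚᵘ-toℚ x) (toℚᵘ-toℚ y) ⟨
  ℚ.toℚᵘ (toℚ x) ℚᵘ.* ℚ.toℚᵘ (toℚ y)         ≈⟨ ℚ.toℚᵘ-homo-* (toℚ x) (toℚ y) ⟨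
  ℚ.toℚᵘ (toℚ x ℚ.* toℚ y)                   ∎)
  where open ℚᵘ.≃-Reasoning

toℚ-↥ : ∀ q → toℚ (↥ q) ≡ toℚ (↧ q) ℚ.* q
toℚ-↥ q@(mkℚ n d _) = ℚ.toℚᵘ-injective (begin
  ℚ.toℚᵘ (toℚ n)                      ≡⟨ toℚᵘ-toℚ n ⟩
  mkℚᵘ n 0                            ≈⟨ *≡* (cross n (+ suc d)) ⟩
  mkℚᵘ (+ suc d) 0 ℚᵘ.* ℚ.toℚᵘ q      ≡⟨ cong (ℚᵘ._* ℚ.toℚᵘ q) (toℚᵘ-toℚ (+ suc d)) ⟨
  ℚ.toℚᵘ (toℚ (+ suc d)) ℚᵘ.* ℚ.toℚᵘ q ≈⟨ ℚ.toℚᵘ-homo-* (toℚ (+ suc d)) q ⟨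
  ℚ.toℚᵘ (toℚ (+ suc d) ℚ.* q)        ∎)
  where
  open ℚᵘ.≃-Reasoning
  cross : ∀ n m → n * (+ 1 * m) ≡ (m * n) * + 1
  cross = solve-∀

record ClearedDenominators (cs : List ℚ) (lead : ℚ) : Set where
  field
    scale         : ℤ
    scale≢0       : scale ≢ 0ℤ
    coeffs        : List ℤ
    leading       : ℤ
    leading≢0     : leading ≢ 0ℤ
    length-coeffs : length coeffs ≡ length cs
    toℚ-evalℤ     : ∀ x → toℚ (evalℤ (coeffs ++ [ leading ]) x)
                          ≡ toℚ scale ℚ.* eval (cs ++ [ lead ]) (toℚ x)

clear-denominators-∷ : ∀ c {cs lead} → ClearedDenominators cs lead → ClearedDenominators (c ∷ cs) lead
clear-denominators-∷ c {cs} {lead} cleared = record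
  { scale         = ↧ c * scale
  ; scale≢0       = [ (λ ()) , scale≢0 ]′ ∘ ℤ.i*j≡0⇒i≡0∨j≡0 (↧ c)
  ; coeffs        = ↥ c * scale ∷ map (↧ c *_) coeffs
  ; leading       = ↧ c * leading
  ; leading≢0     = [ (λ ()) , leading≢0 ]′ ∘ ℤ.i*j≡0⇒i≡0∨j≡0 (↧ c)
  ; length-coeffs = cong suc (trans (List.length-map (↧ c *_) coeffs) length-coeffs)
  ; toℚ-evalℤ     = toℚ-evalℤ′
  }
  where
  open ClearedDenominators cleared
  toℚ-evalℤ′ : ∀ x → toℚ (↥ c * scale + x * evalℤ (map (↧ c *_) coeffs ++ [ ↧ c * leading ]) x)
                     ≡ toℚ (↧ c * scale) ℚ.* eval (c ∷ cs ++ [ lead ]) (toℚ x)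
  toℚ-evalℤ′ x = begin
    toℚ (↥ c * scale + x * evalℤ (map (↧ c *_) coeffs ++ [ ↧ c * leading ]) x)
      ≡⟨ cong (λ v → toℚ (↥ c * scale + x * v)) scaled ⟩
    toℚ (↥ c * scale + x * (↧ c * E))
      ≡⟨ toℚ-+ (↥ c * scale) (x * (↧ c * E)) ⟩
    toℚ (↥ c * scale) ℚ.+ toℚ (x * (↧ c * E))
      ≡⟨ cong₂ ℚ._+_ (toℚ-* (↥ c) scale) (trans (toℚ-* x (↧ c * E)) (cong (toℚ x ℚ.*_) (toℚ-* (↧ c) E))) ⟩
    toℚ (↥ c) ℚ.* toℚ scale ℚ.+ toℚ x ℚ.* (toℚ (↧ c) ℚ.* toℚ E)
      ≡⟨ cong₂ (λ u v → u ℚ.* toℚ scale ℚ.+ toℚ x ℚ.* (toℚ (↧ c) ℚ.* v)) (toℚ-↥ c) (toℚ-evalℤ x) ⟩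
    (toℚ (↧ c) ℚ.* c) ℚ.* toℚ scale ℚ.+ toℚ x ℚ.* (toℚ (↧ c) ℚ.* (toℚ scale ℚ.* p[x]))
      ≡⟨ factor (toℚ (↧ c)) (toℚ scale) c (toℚ x) p[x] ⟩
    (toℚ (↧ c) ℚ.* toℚ scale) ℚ.* (c ℚ.+ toℚ x ℚ.* p[x])
      ≡⟨ cong (ℚ._* _) (toℚ-* (↧ c) scale) ⟨
    toℚ (↧ c * scale) ℚ.* eval (c ∷ cs ++ [ lead ]) (toℚ x) ∎
    where
    open ≡-Reasoning
    E : ℤ
    E = evalℤ (coeffs ++ [ leading ]) x
    p[x] : ℚ
    p[x] = eval (cs ++ [ lead ]) (toℚ x)
    scaled : evalℤ (map (↧ c *_) coeffs ++ [ ↧ c * leading ]) x ≡ ↧ c * E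
    scaled = trans (cong (λ ps → evalℤ ps x) (sym (List.map-++ (↧ c *_) coeffs [ leading ])))
                   (evalℤ-scale (↧ c) (coeffs ++ [ leading ]) x)
    factor : ∀ d m c y e →
      (d ℚ.* c) ℚ.* m ℚ.+ y ℚ.* (d ℚ.* (m ℚ.* e)) ≡ (d ℚ.* m) ℚ.* (c ℚ.+ y ℚ.* e)
    factor = solve 5 (λ d m c y e →
      (d :* c) :* m :+ y :* (d :* (m :* e)) := (d :* m) :* (c :+ y :* e)) refl
      where open +-*-Solver

clear-denominators : ∀ cs lead → lead ≢ 0ℚ → ClearedDenominators cs lead
clear-denominators (c ∷ cs) lead lead≢0 = clear-denominators-∷ c (clear-denominators cs lead lead≢0)
clear-denominators []       lead lead≢0 = record
  { scale         = ↧ lead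
  ; scale≢0       = λ ()
  ; coeffs        = []
  ; leading       = ↥ lead
  ; leading≢0     = lead≢0 ∘ ℚ.↥p≡0⇒p≡0 lead
  ; length-coeffs = refl
  ; toℚ-evalℤ     = λ x → begin
      toℚ (evalℤ [ ↥ lead ] x)                  ≡⟨ cong toℚ (evalℤ-[c] (↥ lead) x) ⟩
      toℚ (↥ lead)                              ≡⟨ toℚ-↥ lead ⟩
      toℚ (↧ lead) ℚ.* lead                     ≡⟨ cong (toℚ (↧ lead) ℚ.*_) (eval-[c] lead (toℚ x)) ⟨
      toℚ (↧ lead) ℚ.* eval [ lead ] (toℚ x)    ∎
  }
  where
  open ≡-Reasoning
  eval-[c] : ∀ c x → eval [ c ] x ≡ c
  eval-[c] c x = trans (cong (c ℚ.+_) (ℚ.*-zeroʳ x)) (ℚ.+-identityʳ c)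

lemma3p9 : (cs : List ℚ) (lead : ℚ) → lead ≢ Data.Rational.0ℚ → 2 ≤ length cs →
    IsIntegral (cs ++ [ lead ]) →
    ¬ (∃ λ (f : ℕ → ℤ) → Injective _≡_ _≡_ f ×
         (∀ (i j : ℕ) → i < j → InValues (cs ++ [ lead ]) (f j - f i)))
lemma3p9 cs lead lead≢0 2≤length _ (f , f-injective , differences-in-values) =
  no-Δ-sequence-in-values coeffs leading leading≢0 (subst (2 ≤_) (sym length-coeffs) 2≤length)
    (λ i → scale * f i) (f-injective ∘ ℤ.*-cancelˡ-≡ scale _ _ {{≢-nonZero scale≢0}}) scaled-differences
  where
  open ClearedDenominators (clear-denominators cs lead lead≢0)
  scaled-differences : ∀ i j → i < j →
    ∃ λ n → evalℤ (coeffs ++ [ leading ]) n ≡ scale * f j - scale * f i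
  scaled-differences i j i<j with differences-in-values i j i<j
  ... | n , p[n]≡ = n , toℚ-injective (begin
    toℚ (evalℤ (coeffs ++ [ leading ]) n)     ≡⟨ toℚ-evalℤ n ⟩
    toℚ scale ℚ.* eval (cs ++ [ lead ]) (toℚ n) ≡⟨ cong (toℚ scale ℚ.*_) p[n]≡ ⟩
    toℚ scale ℚ.* toℚ (f j - f i)              ≡⟨ toℚ-* scale (f j - f i) ⟨
    toℚ (scale * (f j - f i))                  ≡⟨ cong toℚ (distribˡ-- scale (f j) (f i)) ⟩
    toℚ (scale * f j - scale * f i)            ∎)
    where
    open ≡-Reasoning
    distribˡ-- : ∀ m a b → m * (a - b) ≡ m * a - m * b
    distribˡ-- = solve-∀
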